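{- If for all sets $A$ and $B$ which both have the strong Myhill property the set $A^B$ of functions $B \to A$ has the Myhill property, then excluded middle holds (i.e. $p \vee \neg p$ for every $p \in \Omega$).
   Context: The statement is to be proved constructively (intuitionistic set theory with powersets and $\mathbb{N}$, equivalently the internal logic of a topos with natural numbers object; neither excluded middle nor choice is assumed). $\Omega = \mathcal{P}(1)$ is the set of truth values. A set $X$ has the Myhill property if for all subsets $A, B \subseteq X$: if there are injections $f, g : X \to X$ with $A = f^{ -1}(B)$ and $B = g^{ -1}(A)$, then there is a bijection $h : X \to X$ which restricts to a bijection between $A$ and $B$. For injections $f, g : X \to X$ and $m \in \mathbb{Z}$, let $R^{f,g}_m \subseteq X \times X$ be the partial injection $f \circ (g \circ f)^m$: for $m \ge 0$, $(x,y) \in R^{f,g}_m$ iff $y = f((g\circ f)^m(x))$; for $m < 0$, $(x,y) \in R^{f,g}_m$ iff $x = g((f \circ g)^{ -m-1}(y))$. A set $X$ has the strong Myhill property if for every pair of injections $f, g : X \to X$ there is a bijection $h : X \to X$ whose graph is contained in $\bigcup_{m \in \mathbb{Z}} R^{f,g}_m$. -}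

module Defs where

open import Data.Integer.Base using (ℤ; +_; -[1+_])
open import Data.Nat.GeneralisedArithmetic using (fold)
open import Data.Product using (Σ; Σ-syntax; ∃-syntax; _×_; map; proj₁)
open import Data.Sum using (_⊎_)
open import Function.Base using (_∘_)
open import Function.Bundles using (Injection; Bijection)
open import Function.Definitions using (Bijective)
import Function.Relation.Binary.Setoid.Equality as FunctionSpace
open import Level using (Level; suc)
open import Relation.Binary.Bundles using (Setoid)
open import Relation.Binary.Definitions using (_Respects_)
import Relation.Binary.Construct.On as On
open import Relation.Nullary using (¬_)
open import Relation.Unary using (Pred; _≐_; _⊢_)

private
  variable
    ℓ : Level

-- Sets are setoids, so that function sets carry extensional equality, and
-- truth values are types.  All data live in one level ℓ: the carrier and the
-- equality of a set, membership in a subset, and the truth values in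
-- excluded middle.

SetOf : (ℓ : Level) → Set (suc ℓ)
SetOf ℓ = Setoid ℓ ℓ

infixl 8 _^_

_^_ : SetOf ℓ → SetOf ℓ → SetOf ℓ
A ^ B = FunctionSpace.setoid B A

record Subset (X : SetOf ℓ) : Set (suc ℓ) where
  open Setoid X using (Carrier; _≈_)
  field
    member  : Pred Carrier ℓ
    respect : member Respects _≈_

open Subset public

-- The equality of elements of A is that of X: membership proofs are ignored.
⟪_⟫ : {X : SetOf ℓ} → Subset X → SetOf ℓ
⟪_⟫ {X = X} A = On.setoid {B = Σ (Setoid.Carrier X) (member A)} X proj₁

RestrictsToBijection : {X : SetOf ℓ} → Bijection X X → (A B : Subset X) → Set ℓ
RestrictsToBijection h A B =
  Σ[ h[A]⊆B ∈ (∀ {x} → member A x → member B (to x)) ]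
    Bijective (Setoid._≈_ ⟪ A ⟫) (Setoid._≈_ ⟪ B ⟫) (map to h[A]⊆B)
  where open Bijection h using (to)

Myhill : SetOf ℓ → Set (suc ℓ)
Myhill X =
  (A B : Subset X) (f g : Injection X X) →
  member A ≐ (Injection.to f ⊢ member B) →
  member B ≐ (Injection.to g ⊢ member A) →
  Σ[ h ∈ Bijection X X ] RestrictsToBijection h A B

-- R f g m is the graph of the partial injection f ∘ (g ∘ f)ᵐ.
R : {X : SetOf ℓ} (f g : Injection X X) → ℤ →
    Setoid.Carrier X → Setoid.Carrier X → Set ℓ
R {X = X} f g = λ where
    (+ n)    x y → y ≈ F (fold x (G ∘ F) n)
    -[1+ n ] x y → x ≈ G (fold y (F ∘ G) n)  -- n = - m - 1
  where
  open Setoid X using (_≈_)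
  open Injection f using () renaming (to to F)
  open Injection g using () renaming (to to G)

StrongMyhill : SetOf ℓ → Set ℓ
StrongMyhill X =
  (f g : Injection X X) →
  Σ[ h ∈ Bijection X X ]
    (∀ x y → Bijection.to h x ≈ y → ∃[ m ] R f g m x y)
  where open Setoid X using (_≈_)

ExcludedMiddle : (ℓ : Level) → Set (suc ℓ)
ExcludedMiddle ℓ = (p : Set ℓ) → p ⊎ ¬ p

{-# OPTIONS --safe #-}

-- Given p, let F = {blank, bit false, bit true} with the two bits identified
-- iff p.  Both F and ℕ have the strong Myhill property: for F because its
-- injections are bijections, for ℕ by Myhill's back-and-forth argument.  In
-- F ^ ℕ prefixing a blank is an injection f, and prefixing bit false to those
-- sequences which do not start with a blank is an injection g.  Let 𝒜 consist
-- of the sequences blank … blank i i i … with a bit i, and let ℬ = g⁻¹(𝒜).  Every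
-- element of 𝒜 has a twin in 𝒜, with the opposite tail, and equals it iff p.
-- But g maps the constant sequence true into 𝒜 only if p, so that an element of
-- ℬ either starts with a blank or equals the constant sequence false, and it is
-- decidable which.  If a bijection h from 𝒜 to ℬ maps x to the constant sequence
-- false, deciding whether h maps the twin of x there too decides p.

module Submission where

open import Defs

open import Data.Bool.Base using (Bool; true; false; not)
open import Data.Empty using (⊥-elim)
open import Data.Fin.Base using (Fin; toℕ)
open import Data.Fin.Patterns using (0F; 1F; 2F)
open import Data.Fin.Properties using (pigeonhole)
open import Data.Integer.Base using (+_; -[1+_])
open import Data.List.Base using (List; []; _∷_; length; filter; map)
open import Data.List.Membership.Propositional using (_∈_; _∉_; find; lose)
open import Data.List.Membership.Propositional.Properties
  using (∈-filter⁺; ∈-filter⁻; ∈-map⁺; ∈-map⁻)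
open import Data.List.Properties using (filter-notAll)
open import Data.List.Relation.Binary.Subset.Propositional using (_⊆_)
open import Data.List.Relation.Unary.Any using (here; there; any?)
open import Data.Nat.Base using (ℕ; zero; suc; _+_; _<_; _≤′_; ≤′-refl; ≤′-step; s<s)
open import Data.Nat.GeneralisedArithmetic using (fold; fold-+)
open import Data.Nat.Induction using (<-wellFounded)
open import Data.Nat.Properties using (+-comm; n<1+n; ≤-total; ≤⇒≤′)
import Data.Nat.Properties as ℕ
open import Data.Product using (∃-syntax; _×_; _,_; proj₁; proj₂; swap)
open import Data.Sum using (_⊎_; inj₁; inj₂)
open import Function.Base using (_∘_; case_of_; flip; id)
open import Function.Bundles
  using (Func; Injection; Bijection; RightInverse; _↪_; mk↪)
open import Function.Definitions using (Injective)
open import Induction.WellFounded using (Acc; acc)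
open import Level using (Level; _⊔_; Lift; lift; lower)
open import Relation.Binary.Bundles using (Setoid)
open import Relation.Binary.Definitions using (DecidableEquality)
open import Relation.Binary.PropositionalEquality
  using (_≡_; _≢_; refl; sym; trans; cong; subst; setoid; module ≡-Reasoning)
open import Relation.Nullary using (¬_; Dec; yes; no)
open import Relation.Nullary.Decidable using (map′; ¬?)

private
  variable
    a c ℓ : Level
    A B : Set a

-- Finite sets

-- By pigeonhole two iterates of `y` under `f` coincide; cancelling the common applications of `f`
-- puts `y` in the image, so `f` itself is the bijection. `code` may separate equal elements, which
-- admits sets with undecided equality.
finitelyIndexed⇒StrongMyhill :
  (X : SetOf ℓ) → let open Setoid X in
  ∀ {n} (code : Carrier → Fin n) → (∀ {x y} → code x ≡ code y → x ≈ y) →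
  StrongMyhill X
finitelyIndexed⇒StrongMyhill X {n} code code-reflects f g =
  record
    { to        = to
    ; cong      = f-cong
    ; bijective = injective , λ y →
        let x , y≈fx = surjective y in
        x , λ z≈x → X.trans (f-cong z≈x) (X.sym y≈fx)
    } ,
  λ x y fx≈y → + 0 , X.sym fx≈y
  where
  module X = Setoid X
  open X using (_≈_)
  open Injection f using (to; injective) renaming (cong to f-cong)

  cancel : ∀ i j y → i < j → fold y to i ≈ fold y to j → ∃[ x ] y ≈ to x
  cancel zero    (suc j) y _         eq = fold y to j , eq
  cancel (suc i) (suc j) y (s<s i<j) eq = cancel i j y i<j (injective eq)

  surjective : ∀ y → ∃[ x ] y ≈ to x
  surjective y
    with i , j , i<j , eq ← pigeonhole (n<1+n n) (code ∘ fold y to ∘ toℕ)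
    = cancel (toℕ i) (toℕ j) y i<j (code-reflects eq)

-- Back and forth

-- The form of transitivity that makes sense for a relation between two different sets.
Difunctional : (A → B → Set c) → Set _
Difunctional C = ∀ {x x′ y y′} → C x y → C x′ y → C x′ y′ → C x y′

record FiniteMatching {A B : Set a} (C : A → B → Set c) : Set (a ⊔ c) where
  field
    pairs      : List (A × B)
    linked     : ∀ {x y} → (x , y) ∈ pairs → C x y
    functional : ∀ {x y y′} → (x , y) ∈ pairs → (x , y′) ∈ pairs → y ≡ y′
    injective  : ∀ {x x′ y} → (x , y) ∈ pairs → (x′ , y) ∈ pairs → x ≡ x′

open FiniteMatching

empty : {A B : Set a} {C : A → B → Set c} → FiniteMatching C
empty = record
  { pairs      = []
  ; linked     = λ ()
  ; functional = λ ()
  ; injective  = λ ()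
  }

∈-swap⁻ : ∀ {x : A} {y : B} {ps} → (y , x) ∈ map swap ps → (x , y) ∈ ps
∈-swap⁻ m with _ , m′ , refl ← ∈-map⁻ swap m = m′

inRange? : DecidableEquality B →
           ∀ y (ps : List (A × B)) → Dec (∃[ x ] (x , y) ∈ ps)
inRange? _≟_ y ps =
  map′ (λ any → case find any of λ { (_ , m , refl) → _ , m })
       (λ (_ , m) → lose m refl)
       (any? (λ p → proj₂ p ≟ y) ps)

inDomain? : DecidableEquality A →
            ∀ x (ps : List (A × B)) → Dec (∃[ y ] (x , y) ∈ ps)
inDomain? _≟_ x ps =
  map′ (λ (y , m) → y , ∈-swap⁻ m) (λ (y , m) → y , ∈-map⁺ swap m)
       (inRange? _≟_ x (map swap ps))

converse : {A B : Set a} {C : A → B → Set c} →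
           FiniteMatching C → FiniteMatching (flip C)
converse M = record
  { pairs      = map swap (pairs M)
  ; linked     = linked M ∘ ∈-swap⁻
  ; functional = λ m m′ → injective M (∈-swap⁻ m) (∈-swap⁻ m′)
  ; injective  = λ m m′ → functional M (∈-swap⁻ m) (∈-swap⁻ m′)
  }

module Insertion
  {A B : Set a} {C : A → B → Set c} (_≟ᴬ_ : DecidableEquality A)
  (_≟ᴮ_ : DecidableEquality B) (difunctional : Difunctional C)
  (f : A → B) (f-injective : Injective _≡_ _≡_ f) (f-linked : ∀ x → C x (f x))
  where

  target≢? : ∀ y (p : A × B) → Dec (proj₂ p ≢ y)
  target≢? y p = ¬? (proj₂ p ≟ᴮ y)

  removeTarget : B → FiniteMatching C → FiniteMatching C
  removeTarget y M = record
    { pairs      = filter (target≢? y) (pairs M)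
    ; linked     = linked M ∘ kept
    ; functional = λ m m′ → functional M (kept m) (kept m′)
    ; injective  = λ m m′ → injective M (kept m) (kept m′)
    }
    where
    kept : filter (target≢? y) (pairs M) ⊆ pairs M
    kept = proj₁ ∘ ∈-filter⁻ (target≢? y)

  -- If f x is already the partner of x₁, discard that pair and continue with
  -- x₁.  The result is the image of x or of a point of the domain, which is
  -- what keeps it apart from the discarded f x.
  freshTarget :
    (M : FiniteMatching C) → Acc _<_ (length (pairs M)) →
    ∀ x → (∀ {y} → (x , y) ∉ pairs M) →
    ∃[ x′ ] C x (f x′) × (∀ {z} → (z , f x′) ∉ pairs M) ×
            (x′ ≡ x ⊎ ∃[ y ] (x′ , y) ∈ pairs M)
  freshTarget M (acc rec) x x∉ with inRange? _≟ᴮ_ (f x) (pairs M)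
  ... | no  fx∉       = x , f-linked x , (λ m → fx∉ (_ , m)) , inj₁ refl
  ... | yes (x₁ , m₁)
    with x′ , x₁~fx′ , fx′∉ , x′∈ ←
      freshTarget (removeTarget (f x) M)
        (rec (filter-notAll (target≢? (f x)) (pairs M) (lose m₁ (λ ≢fx → ≢fx refl))))
        x₁
        -- The only partner of `x₁` was `f x`, so `x₁` has now left the domain.
        (λ m → let m′ , ≢fx = ∈-filter⁻ (target≢? (f x)) m in
               ≢fx (functional M m′ m₁))
    -- The links run from `x` to `f x`, back to `x₁`, and on to `f x′`.
    = x′ , difunctional (f-linked x) (linked M m₁) x₁~fx′ ,
      (λ m → fx′∉ (∈-filter⁺ (target≢? (f x)) m fx′≢fx)) , inj₂ (inDomain x′∈)
    where
    inDomain : x′ ≡ x₁ ⊎ (∃[ y ] (x′ , y) ∈ pairs (removeTarget (f x) M)) →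
               ∃[ y ] (x′ , y) ∈ pairs M
    inDomain (inj₁ refl)    = f x , m₁
    inDomain (inj₂ (y , m)) = y , proj₁ (∈-filter⁻ (target≢? (f x)) m)

    fx′≢fx : f x′ ≢ f x
    fx′≢fx eq with refl ← f-injective eq = x∉ (proj₂ (inDomain x′∈))

  insert : ∀ x (M : FiniteMatching C) →
           ∃[ M′ ] pairs M ⊆ pairs {C = C} M′ × ∃[ y ] (x , y) ∈ pairs M′
  insert x M with inDomain? _≟ᴬ_ x (pairs M)
  ... | yes x∈ = M , id , x∈
  ... | no  x∉
    with x′ , x~fx′ , fx′∉ , _ ←
      freshTarget M (<-wellFounded _) x (λ m → x∉ (_ , m))
    = record
        { pairs      = (x , f x′) ∷ pairs M
        ; linked     = λ where
            (here refl) → x~fx′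
            (there m)   → linked M m
        ; functional = λ where
            (here refl) (here refl) → refl
            (here refl) (there m)   → ⊥-elim (x∉ (_ , m))
            (there m)   (here refl) → ⊥-elim (x∉ (_ , m))
            (there m)   (there m′)  → functional M m m′
        ; injective  = λ where
            (here refl) (here refl) → refl
            (here refl) (there m)   → ⊥-elim (fx′∉ m)
            (there m)   (here refl) → ⊥-elim (fx′∉ m)
            (there m)   (there m′)  → injective M m m′
        } , there , f x′ , here refl

-- Countable sets

module BackAndForth
  {A : Set ℓ} (A↪ℕ : A ↪ ℕ) {C : A → A → Set c} (difunctional : Difunctional C)
  (f g : A → A)
  (f-injective : Injective _≡_ _≡_ f) (f-linked : ∀ x → C x (f x))
  (g-injective : Injective _≡_ _≡_ g) (g-linked : ∀ y → C (g y) y)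
  where

  open RightInverse A↪ℕ using (strictlyInverseʳ) renaming (to to code; from to enum)

  _≟_ : DecidableEquality A
  x ≟ y = map′ code-injective (cong code) (code x ℕ.≟ code y)
    where
    code-injective : code x ≡ code y → x ≡ y
    code-injective eq =
      trans (sym (strictlyInverseʳ x)) (trans (cong enum eq) (strictlyInverseʳ y))

  private
    module Forth = Insertion {C = C} _≟_ _≟_ difunctional f f-injective f-linked
    module Back  = Insertion {C = flip C} _≟_ _≟_
      -- The converse is difunctional by taking the premises in reverse order.
      (λ x~y x′~y x′~y′ → difunctional x′~y′ x′~y x~y) g g-injective g-linked

  insertBoth : ∀ z (M : FiniteMatching C) →
    ∃[ M′ ] pairs M ⊆ pairs {C = C} M′ ×
            (∃[ y ] (z , y) ∈ pairs M′) × (∃[ x ] (x , z) ∈ pairs M′)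
  insertBoth z M =
    let M₁ , M⊆M₁ , y , zy∈ = Forth.insert z M
        M₂ , M₁⊆M₂ , x , xz∈ = Back.insert z (converse M₁)
    in converse M₂ ,
       ∈-map⁺ swap ∘ M₁⊆M₂ ∘ ∈-map⁺ swap ∘ M⊆M₁ ,
       (y , ∈-map⁺ swap (M₁⊆M₂ (∈-map⁺ swap zy∈))) ,
       (x , ∈-map⁺ swap xz∈)

  stage : ℕ → FiniteMatching C
  stage zero    = empty
  stage (suc n) = proj₁ (insertBoth (enum n) (stage n))

  stage-mono : ∀ {m n} → m ≤′ n → pairs (stage m) ⊆ pairs (stage n)
  stage-mono ≤′-refl               = id
  stage-mono (≤′-step {n = n} m≤n) =
    proj₁ (proj₂ (insertBoth (enum n) (stage n))) ∘ stage-mono m≤n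

  -- The union of the growing stages is the graph of the bijection to be built.
  _↔_ : A → A → Set _
  x ↔ y = ∃[ n ] (x , y) ∈ pairs (stage n)

  commonStage : ∀ {x y x′ y′} → x ↔ y → x′ ↔ y′ →
    ∃[ n ] (x , y) ∈ pairs (stage n) × (x′ , y′) ∈ pairs (stage n)
  commonStage (m , xy∈) (n , x′y′∈) with ≤-total m n
  ... | inj₁ m≤n = n , stage-mono (≤⇒≤′ m≤n) xy∈ , x′y′∈
  ... | inj₂ n≤m = m , xy∈ , stage-mono (≤⇒≤′ n≤m) x′y′∈

  ↔-functional : ∀ {x y y′} → x ↔ y → x ↔ y′ → y ≡ y′
  ↔-functional x↔y x↔y′ =
    let n , m , m′ = commonStage x↔y x↔y′ in functional (stage n) m m′

  ↔-injective : ∀ {x x′ y} → x ↔ y → x′ ↔ y → x ≡ x′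
  ↔-injective x↔y x′↔y =
    let n , m , m′ = commonStage x↔y x′↔y in injective (stage n) m m′

  ↔-total : ∀ x → ∃[ y ] x ↔ y
  ↔-total x = subst (λ z → ∃[ y ] z ↔ y) (strictlyInverseʳ x)
    -- `enum (code x)`, which is `x`, is treated in passing from stage `code x` to the next one.
    (let _ , _ , (y , m) , _ = insertBoth (enum (code x)) (stage (code x)) in
     y , suc (code x) , m)

  ↔-surjective : ∀ y → ∃[ x ] x ↔ y
  ↔-surjective y = subst (λ z → ∃[ x ] x ↔ z) (strictlyInverseʳ y)
    (let _ , _ , _ , x , m = insertBoth (enum (code y)) (stage (code y)) in
     x , suc (code y) , m)

  bijection : Bijection (setoid A) (setoid A)
  bijection = record
    { to        = to
    ; cong      = cong to
    ; bijective = (λ {x} {x′} eq →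
                    ↔-injective (to-↔ x) (subst (x′ ↔_) (sym eq) (to-↔ x′))) ,
                  λ y → let x , x↔y = ↔-surjective y in
                        x , λ { refl → ↔-functional (to-↔ x) x↔y }
    }
    where
    to : A → A
    to x = proj₁ (↔-total x)

    to-↔ : ∀ x → x ↔ to x
    to-↔ x = proj₂ (↔-total x)

  bijection-linked : ∀ x → C x (Bijection.to bijection x)
  bijection-linked x = let _ , n , m = ↔-total x in linked (stage n) m

-- Orbits and chains of a pair of maps

module Chains (f g : A → A) where

  k : A → A
  k = g ∘ f

  -- With exponents on both sides, transitivity does not depend on injectivity.
  SameOrbit : A → A → Set _
  SameOrbit x y = ∃[ m ] ∃[ n ] fold x k m ≡ fold y k n

  SameOrbit-sym : ∀ {x y} → SameOrbit x y → SameOrbit y x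
  SameOrbit-sym (m , n , eq) = n , m , sym eq

  SameOrbit-trans : ∀ {x y z} → SameOrbit x y → SameOrbit y z → SameOrbit x z
  SameOrbit-trans {x} {y} {z} (m , n , eq) (m′ , n′ , eq′) =
    m′ + m , n + n′ , (begin
      fold x k (m′ + m)        ≡⟨ fold-+ x k m′ ⟩
      fold (fold x k m) k m′   ≡⟨ cong (λ w → fold w k m′) eq ⟩
      fold (fold y k n) k m′   ≡⟨ fold-+ y k m′ ⟨
      fold y k (m′ + n)        ≡⟨ cong (fold y k) (+-comm m′ n) ⟩
      fold y k (n + m′)        ≡⟨ fold-+ y k n ⟩
      fold (fold y k m′) k n   ≡⟨ cong (λ w → fold w k n) eq′ ⟩
      fold (fold z k n′) k n   ≡⟨ fold-+ z k n ⟨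
      fold z k (n + n′)        ∎)
    where open ≡-Reasoning

  -- Put `x` and `y` in two disjoint copies of `A` and draw edges from each `x` to `f x` and from
  -- each `g y` to `y`: this is lying in the same connected component.
  SameChain : A → A → Set _
  SameChain x y = SameOrbit x (g y)

  SameChain-difunctional : Difunctional SameChain
  SameChain-difunctional x~y x′~y x′~y′ =
    SameOrbit-trans x~y (SameOrbit-trans (SameOrbit-sym x′~y) x′~y′)

  fold-g : ∀ y n → fold (g y) k n ≡ g (fold y (f ∘ g) n)
  fold-g y zero    = refl
  fold-g y (suc n) = cong k (fold-g y n)

-- Injectivity cancels `k` on both sides until one exponent is zero; the side that runs out first
-- gives the sign of the index, and a tie gives -1.
SameChain⇒R : (f g : Injection (setoid A) (setoid A)) →
  let open Chains (Injection.to f) (Injection.to g) in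
  ∀ {x y} → SameChain x y → ∃[ m ] R f g m x y
SameChain⇒R f g (m , n , eq) = index m n eq
  where
  open Chains (Injection.to f) (Injection.to g)

  index : ∀ m n {x y} → fold x k m ≡ fold (Injection.to g y) k n →
          ∃[ i ] R f g i x y
  index zero    n {y = y} eq = -[1+ n ] , trans eq (fold-g y n)
  -- The left side ends in an application of `g`; cancelling it leaves `f` after `m` applications of
  -- `k`.
  index (suc m) zero      eq = + m , sym (Injection.injective g eq)
  index (suc m) (suc n)   eq =
    index m n (Injection.injective f (Injection.injective g eq))

countable⇒StrongMyhill : A ↪ ℕ → StrongMyhill (setoid A)
countable⇒StrongMyhill A↪ℕ f g =
  bijection , λ { x _ refl → SameChain⇒R f g (bijection-linked x) }
  where
  open Chains (Injection.to f) (Injection.to g)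
  open BackAndForth A↪ℕ {C = SameChain} SameChain-difunctional
    (Injection.to f) (Injection.to g)
    -- One application of `k` takes `x` to `g (f x)`.
    (Injection.injective f) (λ _ → 1 , 0 , refl)
    (Injection.injective g) (λ _ → 0 , 0 , refl)

-- Sequences of symbols

data Symbol {ℓ} : Set ℓ where
  blank : Symbol
  bit   : Bool → Symbol

isBit : Symbol {ℓ} → Bool
isBit blank   = false
isBit (bit _) = true

module Twins {ℓ} (p : Set ℓ) where

  -- The condition on `isBit` keeps `blank` apart from the bits even when `p` holds, so that being
  -- blank stays decidable.
  F : SetOf ℓ
  F = record
    { Carrier       = Symbol
    ; _≈_           = λ s t → isBit s ≡ isBit t × (s ≡ t ⊎ p)
    ; isEquivalence = record
      { refl  = refl , inj₁ refl
      ; sym   = λ where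
          (eq , inj₁ s≡t) → sym eq , inj₁ (sym s≡t)
          (eq , inj₂ w)   → sym eq , inj₂ w
      ; trans = λ where
          (eq , inj₁ s≡t) (eq′ , inj₁ t≡u) → trans eq eq′ , inj₁ (trans s≡t t≡u)
          (eq , inj₂ w)   (eq′ , _)        → trans eq eq′ , inj₂ w
          (eq , inj₁ _)   (eq′ , inj₂ w)   → trans eq eq′ , inj₂ w
      }
    }

  module F = Setoid F

  F-strongMyhill : StrongMyhill F
  F-strongMyhill = finitelyIndexed⇒StrongMyhill F code (F.reflexive ∘ code-injective)
    where
    code : Symbol → Fin 3
    code blank       = 0F
    code (bit false) = 1F
    code (bit true)  = 2F

    code-injective : ∀ {s t} → code s ≡ code t → s ≡ t
    code-injective {blank}     {blank}     _ = refl
    code-injective {bit false} {bit false} _ = refl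
    code-injective {bit true}  {bit true}  _ = refl
    code-injective {blank}     {bit false} ()
    code-injective {blank}     {bit true}  ()

  N : SetOf ℓ
  N = setoid (Lift ℓ ℕ)

  N-strongMyhill : StrongMyhill N
  N-strongMyhill = countable⇒StrongMyhill (mk↪ {to = lower} {from = lift} λ { refl → refl })

  X : SetOf ℓ
  X = F ^ N

  module X = Setoid X
  open X using (_≈_)

  infixl 9 _‼_
  _‼_ : X.Carrier → ℕ → F.Carrier
  x ‼ n = Func.to x (lift n)

  infixr 5 _◂_
  _◂_ : F.Carrier → X.Carrier → X.Carrier
  s ◂ x = record
    { to   = λ where
        (lift zero)    → s
        (lift (suc n)) → x ‼ n
    ; cong = λ { refl → F.refl }
    }

  ◂-cong : ∀ {s t x y} → s F.≈ t → x ≈ y → s ◂ x ≈ t ◂ y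
  ◂-cong s≈t x≈y (lift zero)    = s≈t
  ◂-cong s≈t x≈y (lift (suc n)) = x≈y (lift n)

  tail-cong : ∀ {s t x y} → s ◂ x ≈ t ◂ y → x ≈ y
  tail-cong eq (lift n) = eq (lift (suc n))

  constant : F.Carrier → X.Carrier
  constant s = record { to = λ _ → s ; cong = λ _ → F.refl }

  blanksThen : ℕ → Bool → X.Carrier
  blanksThen zero    i = constant (bit i)
  blanksThen (suc n) i = blank ◂ blanksThen n i

  twins-≈ : p → ∀ n i j → blanksThen n i ≈ blanksThen n j
  twins-≈ w zero    i j = λ _ → refl , inj₂ w
  twins-≈ w (suc n) i j = ◂-cong F.refl (twins-≈ w n i j)

  -- At the first entry behind the blanks stand opposite bits, whose equality in `F` can only come
  -- from `p`.
  twins-≈⇒p : ∀ n i → blanksThen n (not i) ≈ blanksThen n i → p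
  twins-≈⇒p zero i eq with i | eq (lift 0)
  ... | _     | _ , inj₂ w  = w
  ... | false | _ , inj₁ ()
  ... | true  | _ , inj₁ ()
  twins-≈⇒p (suc n) i eq = twins-≈⇒p n i (tail-cong eq)

  f : Injection X X
  f = record
    { to        = blank ◂_
    ; cong      = ◂-cong F.refl
    ; injective = tail-cong
    }

  -- The head is an argument of its own, so that proofs can match on it while knowing it only up to
  -- `F.≈`.
  prefixUnlessBlank : F.Carrier → X.Carrier → X.Carrier
  prefixUnlessBlank blank   x = x
  prefixUnlessBlank (bit _) x = bit false ◂ x

  g : Injection X X
  g = record
    { to        = λ x → prefixUnlessBlank (x ‼ 0) x
    ; cong      = λ {x} {y} x≈y → cong′ (x ‼ 0) (y ‼ 0) (x≈y (lift 0)) x≈y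
    ; injective = λ {x} {y} → injective′ (x ‼ 0) (y ‼ 0) F.refl F.refl
    }
    where
    cong′ : ∀ s t {x y} → s F.≈ t → x ≈ y →
            prefixUnlessBlank s x ≈ prefixUnlessBlank t y
    cong′ blank   blank   _ x≈y = x≈y
    cong′ (bit _) (bit _) _ x≈y = ◂-cong F.refl x≈y
    cong′ blank   (bit _) (() , _)
    cong′ (bit _) blank   (() , _)

    injective′ : ∀ s t {x y} → s F.≈ x ‼ 0 → t F.≈ y ‼ 0 →
                 prefixUnlessBlank s x ≈ prefixUnlessBlank t y → x ≈ y
    injective′ blank   blank   _   _   eq = eq
    injective′ (bit _) (bit _) _   _   eq = tail-cong eq
    -- In the mixed cases one image starts with a blank and the other with a bit.
    injective′ blank   (bit _) s≈x _   eq with () , _ ← F.trans s≈x (eq (lift 0))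
    injective′ (bit _) blank   _   t≈y eq with () , _ ← F.trans t≈y (F.sym (eq (lift 0)))

  -- The two subsets and the decision of `p`

  𝒜 : Subset X
  𝒜 = record
    { member  = λ x → ∃[ n ] ∃[ i ] x ≈ blanksThen n i
    ; respect = λ x≈y (n , i , x≈) → n , i , λ l → F.trans (F.sym (x≈y l)) (x≈ l)
    }

  ℬ : Subset X
  ℬ = record
    { member  = member 𝒜 ∘ Injection.to g
    ; respect = λ {x} {y} x≈y →
        respect 𝒜 {Injection.to g x} {Injection.to g y} (Injection.cong g {x} {y} x≈y)
    }

  falses : X.Carrier
  falses = constant (bit false)

  falses∈ℬ : member ℬ falses
  falses∈ℬ = 0 , false , λ { (lift zero) → F.refl ; (lift (suc _)) → F.refl }

  -- `g` fixes every sequence with a blank head, so `g` after `f` just prefixes a blank.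
  ∈𝒜⇒f∈ℬ : ∀ {x} → member 𝒜 x → member ℬ (blank ◂ x)
  ∈𝒜⇒f∈ℬ (n , i , x≈) = suc n , i , ◂-cong F.refl x≈

  f∈ℬ⇒∈𝒜 : ∀ {x} → member ℬ (blank ◂ x) → member 𝒜 x
  f∈ℬ⇒∈𝒜 (suc n , i , x≈) = n , i , tail-cong x≈
  f∈ℬ⇒∈𝒜 (zero  , i , x≈) with () , _ ← x≈ (lift 0)

  ∈ℬ⇒falses? : ∀ y → member ℬ y → y ≈ falses ⊎ ¬ (y ≈ falses)
  ∈ℬ⇒falses? y = byHead (y ‼ 0) F.refl
    where
    byHead : ∀ s → s F.≈ y ‼ 0 → member 𝒜 (prefixUnlessBlank s y) →
             y ≈ falses ⊎ ¬ (y ≈ falses)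
    byHead blank   s≈y _ = inj₂ λ y≈ → blank≉bit (F.trans s≈y (y≈ (lift 0)))
      where
      blank≉bit : ¬ (blank F.≈ bit false)
      blank≉bit (() , _)
    -- `bit false ◂ y` is constant, so every entry of `y` equals its head `bit false`, whatever `i`
    -- is.
    byHead (bit _) _ (zero , i , eq) =
      inj₁ λ (lift n) → F.trans (eq (lift (suc n))) (F.sym (eq (lift 0)))
    -- The right side of `eq` has a blank head, the left side a bit.
    byHead (bit _) _ (suc n , i , eq) with () , _ ← eq (lift 0)

  decide : Myhill X → p ⊎ ¬ p
  decide myhill
    with h , h[𝒜]⊆ℬ , _ , surjective ←
      myhill 𝒜 ℬ f g (∈𝒜⇒f∈ℬ , f∈ℬ⇒∈𝒜) (id , id)
    with (x , n , i , x≈) , hx≈ ← surjective (falses , falses∈ℬ)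
    -- `twin` lies in `𝒜`, so its image lies in `ℬ`, where equality with `falses` is decidable.
    = answer (∈ℬ⇒falses? (to twin) (h[𝒜]⊆ℬ (n , not i , X.refl {twin})))
    where
    open Bijection h using (to) renaming (cong to h-cong; injective to h-injective)

    twin : X.Carrier
    twin = blanksThen n (not i)

    hx≈falses : to x ≈ falses
    hx≈falses = hx≈ {x , n , i , x≈} (X.refl {x})

    answer : to twin ≈ falses ⊎ ¬ (to twin ≈ falses) → p ⊎ ¬ p
    answer (inj₁ ht≈) =
      inj₁ (twins-≈⇒p n i λ l → F.trans (twin≈x l) (x≈ l))
      where
      twin≈x : twin ≈ x
      twin≈x = h-injective λ l → F.trans (ht≈ l) (F.sym (hx≈falses l))
    -- Under `p` the twin equals `x`, so its image would be `falses`.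
    answer (inj₂ ht≉) = inj₂ λ w →
      let twin≈x l = F.trans (twins-≈ w n (not i) i l) (F.sym (x≈ l)) in
      ht≉ λ l → F.trans (h-cong {twin} {x} twin≈x l) (hx≈falses l)

corollary25 : (ℓ : Level) →
    ((A B : SetOf ℓ) → StrongMyhill A → StrongMyhill B → Myhill (A ^ B)) →
    ExcludedMiddle ℓ
corollary25 ℓ power-Myhill p = decide (power-Myhill F N F-strongMyhill N-strongMyhill)
  where open Twins p
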